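{- Let $T$ be a tree. If $|L(T)|\geq 2(M(T)+2)$, then $\widetilde{T}\notin\mathfrak{N}_{c}$.
   Context: All graphs are finite, undirected, without loops or multiple edges. $d_G(v)$ is the degree of $v$ in $G$. Let $T$ be a tree with $V(T)=\{v_{1},\ldots,v_{n}\}$, $n\geq 2$. For vertices $v_i,v_j$, let $P(v_{i},v_{j})$ be the simple path joining $v_{i}$ and $v_{j}$ in $T$, and let $VP(v_{i},v_{j})$ and $EP(v_{i},v_{j})$ be its sets of vertices and edges. Let $L(T)=\{v\in V(T): d_{T}(v)=1\}$. Define $$LP(v_{i},v_{j})=|EP(v_{i},v_{j})|+\left|\left\{vw: vw\in E(T),\ v\in VP(v_{i},v_{j}),\ w\notin VP(v_{i},v_{j})\right\}\right|$$ and $M(T)=\max_{1\leq i<j\leq n}LP(v_{i},v_{j})$. The graph $\widetilde{T}$ is defined by $V(\widetilde{T})=V(T)\cup\{u\}$ with $u\notin V(T)$, and $E(\widetilde{T})=E(T)\cup\{uv: v\in L(T)\}$. For a positive integer $t$, an interval cyclic $t$-coloring of a graph $G$ is a proper edge-coloring of $G$ with colors $1,\ldots,t$ such that all $t$ colors are used and, for each vertex $v$, the edges incident to $v$ are colored by $d_{G}(v)$ consecutive colors modulo $t$ (i.e. consecutive in the cyclic order $1,2,\ldots,t,1$). $\mathfrak{N}_{c}$ is the set of graphs having an interval cyclic $t$-coloring for some positive integer $t$. -}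

module Defs where

open import Data.Bool.Base using (Bool; true; false; T)
open import Data.Bool.Properties using (T?)
open import Data.Fin.Base using (Fin; zero; suc)
import Data.Fin.Base as Fin
import Data.Fin.Properties as Fin
open import Data.Fin.Subset using (Subset; ∣_∣)
open import Data.List.Base using (List; []; _∷_; length; map; filter; allFin; cartesianProduct)
open import Data.List.Extrema.Nat using (max)
open import Data.List.Membership.Propositional using (_∈_; _∉_)
import Data.List.Membership.DecPropositional as DecMembership
open import Data.List.Relation.Unary.Unique.Propositional using (Unique)
open import Data.Nat.Base using (ℕ; _+_; _≤_; _<_; _≡ᵇ_; NonZero)
open import Data.Nat.DivMod using (_mod_)
open import Data.Product.Base using (Σ-syntax; ∃-syntax; _×_; _,_; proj₁)
open import Function.Bundles using (_⇔_)
open import Level using (0ℓ)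
open import Relation.Binary.PropositionalEquality using (_≡_; refl)
open import Relation.Nullary using (¬_)
open import Relation.Nullary.Decidable using (_×-dec_; ¬?)
open import Relation.Unary using (Pred; Decidable)
import Data.Vec.Base as Vec

record Graph (n : ℕ) : Set where
  field
    adj        : Fin n → Fin n → Bool
    adj-sym    : ∀ v w → adj v w ≡ adj w v
    adj-irrefl : ∀ v → adj v v ≡ false

  Adj : Fin n → Fin n → Set
  Adj v w = T (adj v w)

  neighbours : Fin n → Subset n
  neighbours v = Vec.tabulate (adj v)

  degree : Fin n → ℕ
  degree v = ∣ neighbours v ∣

  data Walk : Fin n → Fin n → Set where
    nil  : ∀ {v} → Walk v v
    cons : ∀ {u v w} → Adj u v → Walk v w → Walk u w

  vertices : ∀ {v w} → Walk v w → List (Fin n)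
  vertices {v} nil          = v ∷ []
  vertices {v} (cons _ p)   = v ∷ vertices p

  edges : ∀ {v w} → Walk v w → List (Fin n × Fin n)
  edges nil                    = []
  edges (cons {u} {v} _ p)     = (u , v) ∷ edges p

  SimplePath : Fin n → Fin n → Set
  SimplePath v w = Σ[ p ∈ Walk v w ] Unique (vertices p)

  Connected : Set
  Connected = ∀ v w → SimplePath v w

  -- A cycle is a simple path with at least two edges together with an edge
  -- joining its two ends.
  Acyclic : Set
  Acyclic = ∀ {v w} ((p , _) : SimplePath v w) → 2 ≤ length (edges p) → ¬ Adj w v

record Tree (n : ℕ) : Set where
  field
    graph     : Graph n
    connected : Graph.Connected graph
    acyclic   : Graph.Acyclic graph

  open Graph graph public

  -- By acyclicity, this is the only simple path from v to w.
  P : ∀ v w → Walk v w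
  P v w = proj₁ (connected v w)

  VP : Fin n → Fin n → List (Fin n)
  VP v w = vertices (P v w)

  EP : Fin n → Fin n → List (Fin n × Fin n)
  EP v w = edges (P v w)

  L : Subset n
  L = Vec.tabulate (λ v → degree v ≡ᵇ 1)

  open DecMembership (Fin._≟_ {n}) using (_∈?_)

  allPairs : List (Fin n × Fin n)
  allPairs = cartesianProduct (allFin n) (allFin n)

  -- The edges with exactly one end on P v w. Each is listed once, as the
  -- ordered pair whose first component is the end on the path.
  boundary : Fin n → Fin n → List (Fin n × Fin n)
  boundary v w = filter leaving? allPairs
    where
    Leaving : Pred (Fin n × Fin n) 0ℓ
    Leaving (x , y) = Adj x y × x ∈ VP v w × y ∉ VP v w

    leaving? : Decidable Leaving
    leaving? (x , y) = T? (adj x y) ×-dec (x ∈? VP v w) ×-dec ¬? (y ∈? VP v w)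

  -- On a simple path no edge repeats, so length (EP v w) counts its edges.
  LP : Fin n → Fin n → ℕ
  LP v w = length (EP v w) + length (boundary v w)

  -- The default 0 only matters when n < 2: otherwise the list is nonempty.
  M : ℕ
  M = max 0 (map (λ (v , w) → LP v w) (filter (λ (v , w) → v Fin.<? w) allPairs))

  -- The added vertex u is zero; the vertex v of the tree becomes suc v.
  tilde : Graph (ℕ.suc n)
  tilde = record { adj = adj′ ; adj-sym = adj′-sym ; adj-irrefl = adj′-irrefl }
    where
    adj′ : Fin (ℕ.suc n) → Fin (ℕ.suc n) → Bool
    adj′ zero    zero    = false
    adj′ zero    (suc w) = Vec.lookup L w
    adj′ (suc v) zero    = Vec.lookup L v
    adj′ (suc v) (suc w) = adj v w

    adj′-sym : ∀ v w → adj′ v w ≡ adj′ w v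
    adj′-sym zero    zero    = refl
    adj′-sym zero    (suc w) = refl
    adj′-sym (suc v) zero    = refl
    adj′-sym (suc v) (suc w) = adj-sym v w

    adj′-irrefl : ∀ v → adj′ v v ≡ false
    adj′-irrefl zero    = refl
    adj′-irrefl (suc v) = adj-irrefl v

-- The colours 1, …, t are represented by Fin t, that is 0, …, t - 1.
record IntervalCyclicColoring {n} (G : Graph n) (t : ℕ) .{{_ : NonZero t}} : Set where
  open Graph G
  field
    color     : ∀ {v w} → Adj v w → Fin t
    color-sym : ∀ {v w} (e : Adj v w) (e′ : Adj w v) → color e ≡ color e′
    proper    : ∀ {v w w′} (e : Adj v w) (e′ : Adj v w′) → color e ≡ color e′ → w ≡ w′
    all-used  : ∀ k → ∃[ v ] ∃[ w ] Σ[ e ∈ Adj v w ] color e ≡ k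
    cyclic    : ∀ v → ∃[ s ] ∀ k →
                (∃[ w ] Σ[ e ∈ Adj v w ] color e ≡ k) ⇔
                (∃[ i ] i < degree v × k ≡ (s + i) mod t)

𝔑c : ∀ {n} → Pred (Graph n) 0ℓ
𝔑c G = ∃[ t ] Σ[ t≢0 ∈ NonZero t ] IntervalCyclicColoring G t {{t≢0}}

module Submission where

-- Suppose that the graph obtained from the tree T by joining a new vertex u,
-- the centre, to all leaves has an interval cyclic t-coloring. Measure colours
-- by their cyclic distance modulo t. Two edges at a vertex of degree d have
-- colours at distance at most d - 1 (near-at).
--
-- Let v and w be distinct leaves, and follow the closed walk from u to v, along
-- the path of T to w, and back to u. The colours of uv and uw then differ by at
-- most 1 at v, by at most d(x) - 1 at each inner vertex x of the path, and by at
-- most 1 at w (near-path). The sum of d(x) - 1 over the inner vertices counts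
-- the edges at these vertices other than the one by which the path arrives.
-- Such an edge leaves the path or is its next edge, because any other chord
-- would close a cycle (chord⇒edge). Since the first edge of the path is not
-- counted, the sum is at most LP(v, w) - 1 (fans<LP). So the colours of uv and
-- uw are at distance at most LP(v, w) + 1, hence at most M + 1 (near-leaves).
--
-- The edges at u carry |L| distinct consecutive colours, so t is at least |L|,
-- and |L| is at least 2(M + 2). The first of these colours and the one M + 2
-- places after it are then at distance at least M + 2 (far-apart), which is a
-- contradiction.

open import Defs
open import Data.Nat.Base using (ℕ; _+_; _*_; _≤_)
open import Data.Fin.Subset using (∣_∣)
open import Relation.Unary using (_∉_)

open import Data.Bool.Base using (Bool; true; false; T)
open import Data.Bool.Properties using (T?; T-irrelevant)
open import Data.Empty using (⊥; ⊥-elim)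
open import Data.Fin.Base using (Fin; zero; suc; toℕ)
import Data.Fin.Base as Fin
import Data.Fin.Properties as Fin
open import Data.List.Base using (List; []; _∷_; _++_; length; lookup; map; filter; allFin; tabulate)
open import Data.List.Extrema.Nat using (xs≤max)
open import Data.List.Membership.Propositional using (_∈_)
import Data.List.Membership.DecPropositional as DecMembership
import Data.List.Membership.Propositional.Properties as Mem
import Data.List.Membership.Setoid.Properties as SetoidMem
open import Data.List.Properties using (length-map; length-++)
open import Data.List.Relation.Unary.All as All using ([]; _∷_)
open import Data.List.Relation.Unary.All.Properties using (¬Any⇒All¬)
open import Data.List.Relation.Unary.AllPairs.Core using ([]; _∷_)
open import Data.List.Relation.Unary.Any using (here; there; index)
open import Data.List.Relation.Unary.Unique.Propositional using (Unique)
import Data.List.Relation.Unary.Unique.Propositional.Properties as Unique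
open import Data.Nat.Base using (_∸_; _<_; _%_; _/_; _≡ᵇ_; NonZero; z≤n; s≤s)
open import Data.Nat.DivMod using (_mod_; m≡m%n+[m/n]*n; m%n<n; [m+kn]%n≡m%n; m<n⇒m%n≡m)
import Data.Nat.Properties as ℕ
open import Data.Nat.Tactic.RingSolver using (solve-∀)
open import Data.Product.Base using (Σ-syntax; ∃-syntax; _×_; _,_; proj₁; proj₂)
open import Data.Product.Properties using (,-injectiveʳ)
open import Data.Sum.Base using (_⊎_; inj₁; inj₂)
import Data.Vec.Base as Vec
open import Data.Vec.Properties using (lookup∘tabulate; tabulate∘lookup)
open import Function.Base using (_∘_; id)
open import Function.Bundles using (Equivalence)
open import Relation.Binary.Definitions using (tri<; tri≈; tri>)
open import Relation.Binary.PropositionalEquality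
open import Relation.Nullary using (¬_; yes; no)
open import Relation.Nullary.Decidable using (¬?)

-- Counting along injections

unique-lookup : ∀ {A : Set} {xs : List A} → Unique xs →
  ∀ {i j} → lookup xs i ≡ lookup xs j → i ≡ j
unique-lookup (_ ∷ _) {zero}  {zero}  _  = refl
unique-lookup (p ∷ _) {zero}  {suc j} eq = ⊥-elim (All.lookup p (Mem.∈-lookup j) eq)
unique-lookup (p ∷ _) {suc i} {zero}  eq = ⊥-elim (All.lookup p (Mem.∈-lookup i) (sym eq))
unique-lookup (_ ∷ u) {suc i} {suc j} eq = cong suc (unique-lookup u eq)

unique-injective⇒≤ : ∀ {A : Set} {xs : List A} {m} → Unique xs →
  (f : ∀ {x} → x ∈ xs → Fin m) →
  (∀ {x y} (p : x ∈ xs) (q : y ∈ xs) → f p ≡ f q → x ≡ y) →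
  length xs ≤ m
unique-injective⇒≤ u f inj =
  Fin.injective⇒≤ {f = λ i → f (Mem.∈-lookup i)} (λ eq → unique-lookup u (inj _ _ eq))

unique-⊆⇒≤ : ∀ {A : Set} {xs ys : List A} → Unique xs →
  (∀ {x} → x ∈ xs → x ∈ ys) → length xs ≤ length ys
unique-⊆⇒≤ {A} u sub =
  unique-injective⇒≤ u (λ p → index (sub p))
    (λ p q → SetoidMem.index-injective (setoid A) (sub p) (sub q))

length-filter-tabulate : ∀ {m} {A : Set} (f : A → Bool) (g : Fin m → A) →
  length (filter (λ x → T? (f x)) (tabulate g)) ≡ ∣ Vec.tabulate (λ i → f (g i)) ∣
length-filter-tabulate {ℕ.zero}  f g = refl
length-filter-tabulate {ℕ.suc m} f g with f (g zero)
... | true  = cong ℕ.suc (length-filter-tabulate f (g ∘ suc))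
... | false = length-filter-tabulate f (g ∘ suc)

-- Distance modulo t

-- The residues of a and b modulo t are at cyclic distance at most d: adding x
-- to a and y to b, with x + y at most d, makes them congruent. Multiples of t
-- on both sides keep the congruence inside the natural numbers.
record Near (t d a b : ℕ) : Set where
  constructor near
  field
    x y p q : ℕ
    x+y≤d   : x + y ≤ d
    meet    : a + x + p * t ≡ b + y + q * t

near-sym : ∀ {t d a b} → Near t d a b → Near t d b a
near-sym {d = d} (near x y p q le eq) =
  near y x q p (subst (_≤ d) (ℕ.+-comm x y) le) (sym eq)

near-weaken : ∀ {t d d′ a b} → d ≤ d′ → Near t d a b → Near t d′ a b
near-weaken d≤d′ (near x y p q le eq) = near x y p q (ℕ.≤-trans le d≤d′) eq

near-refl : ∀ {t a} → Near t 0 a a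
near-refl = near 0 0 0 0 z≤n refl

near-trans : ∀ {t d d′ a b c} → Near t d a b → Near t d′ b c → Near t (d + d′) a c
near-trans {t} {d} {d′} {a} {b} {c} (near x y p q le eq) (near x′ y′ p′ q′ le′ eq′) =
  near (x + x′) (y + y′) (p + p′) (q + q′)
    (subst (_≤ d + d′) (shuffle x y x′ y′) (ℕ.+-mono-≤ le le′))
    (begin
      a + (x + x′) + (p + p′) * t         ≡⟨ regroup a x x′ p p′ t ⟩
      (a + x + p * t) + (x′ + p′ * t)     ≡⟨ cong (_+ (x′ + p′ * t)) eq ⟩
      (b + y + q * t) + (x′ + p′ * t)     ≡⟨ exchange b y x′ q p′ t ⟩
      (b + x′ + p′ * t) + (y + q * t)     ≡⟨ cong (_+ (y + q * t)) eq′ ⟩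
      (c + y′ + q′ * t) + (y + q * t)     ≡⟨ collect c y y′ q q′ t ⟩
      c + (y + y′) + (q + q′) * t         ∎)
  where
  open ≡-Reasoning
  shuffle : ∀ x y x′ y′ → x + y + (x′ + y′) ≡ x + x′ + (y + y′)
  shuffle = solve-∀
  regroup : ∀ a x x′ p p′ t → a + (x + x′) + (p + p′) * t ≡ (a + x + p * t) + (x′ + p′ * t)
  regroup = solve-∀
  exchange : ∀ b y x′ q p′ t →
    (b + y + q * t) + (x′ + p′ * t) ≡ (b + x′ + p′ * t) + (y + q * t)
  exchange = solve-∀
  collect : ∀ c y y′ q q′ t →
    (c + y′ + q′ * t) + (y + q * t) ≡ c + (y + y′) + (q + q′) * t
  collect = solve-∀

toℕ-mod : ∀ m t .{{_ : NonZero t}} → m ≡ toℕ (m mod t) + (m / t) * t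
toℕ-mod m t = trans (m≡m%n+[m/n]*n m t)
  (cong (_+ (m / t) * t) (sym (Fin.toℕ-fromℕ< (m%n<n m t))))

-- The quotients of m and n by t serve as the two multiples of t.
near-mod : ∀ {d} m n x y t .{{_ : NonZero t}} → x + y ≤ d → m + x ≡ n + y →
  Near t d (toℕ (m mod t)) (toℕ (n mod t))
near-mod m n x y t le eq = near x y (m / t) (n / t) le
  (trans (split m x) (trans eq (sym (split n y))))
  where
  swap : ∀ a b c → a + b + c ≡ a + c + b
  swap = solve-∀
  split : ∀ m x → toℕ (m mod t) + x + (m / t) * t ≡ m + x
  split m x = trans (swap (toℕ (m mod t)) x ((m / t) * t))
                    (cong (_+ x) (sym (toℕ-mod m t)))

-- Any two of D + 1 consecutive residues are at distance at most D.
near-interval : ∀ {i j D} s t .{{_ : NonZero t}} → i < ℕ.suc D → j < ℕ.suc D →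
  Near t D (toℕ ((s + i) mod t)) (toℕ ((s + j) mod t))
near-interval {i} {j} {D} s t (s≤s i≤D) (s≤s j≤D) with ℕ.≤-total i j
... | inj₁ i≤j = near-mod (s + i) (s + j) (j ∸ i) 0 t
  (subst (_≤ D) (sym (ℕ.+-identityʳ _)) (ℕ.≤-trans (ℕ.m∸n≤m j i) j≤D))
  (trans (ℕ.+-assoc s i _) (trans (cong (s +_) (ℕ.m+[n∸m]≡n i≤j)) (sym (ℕ.+-identityʳ _))))
... | inj₂ j≤i = near-mod (s + i) (s + j) 0 (i ∸ j) t
  (ℕ.≤-trans (ℕ.m∸n≤m i j) i≤D)
  (trans (ℕ.+-identityʳ _) (sym (trans (ℕ.+-assoc s j _) (cong (s +_) (ℕ.m+[n∸m]≡n j≤i)))))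

-- Residues differing by d + 1 are at distance more than d when t is at least
-- 2(d + 1).
far-apart : ∀ {d t} s .{{_ : NonZero t}} → 2 * ℕ.suc d ≤ t →
  ¬ Near t d (toℕ ((s + 0) mod t)) (toℕ ((s + ℕ.suc d) mod t))
far-apart {d} {t} s bound (near x y p q le eq) = ℕ.<-irrefl x≡ x<
  where
  open ≡-Reasoning
  A = toℕ ((s + 0) mod t)
  B = toℕ ((s + ℕ.suc d) mod t)
  P′ = (s + 0) / t
  Q′ = (s + ℕ.suc d) / t

  insert : ∀ s a x p q p′ t → s + 0 ≡ a + p′ * t →
    s + (x + (p + q) * t) ≡ (a + x + p * t) + (p′ + q) * t
  insert s a x p q p′ t h = trans (r₁ s x p q t)
    (trans (cong (_+ (x + (p + q) * t)) h) (r₂ a x p q p′ t))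
    where
    r₁ : ∀ s x p q t → s + (x + (p + q) * t) ≡ s + 0 + (x + (p + q) * t)
    r₁ = solve-∀
    r₂ : ∀ a x p q p′ t →
      a + p′ * t + (x + (p + q) * t) ≡ (a + x + p * t) + (p′ + q) * t
    r₂ = solve-∀

  r₃ : ∀ b y q p′ q′ t →
    (b + y + q * t) + (p′ + q′) * t ≡ (b + q′ * t) + (y + (q + p′) * t)
  r₃ = solve-∀
  r₄ : ∀ s e y k t → s + e + (y + k * t) ≡ s + (e + y + k * t)
  r₄ = solve-∀

  eqℕ : x + (p + Q′) * t ≡ ℕ.suc d + y + (q + P′) * t
  eqℕ = ℕ.+-cancelˡ-≡ s _ _ (begin
    s + (x + (p + Q′) * t)                  ≡⟨ insert s A x p Q′ P′ t (toℕ-mod (s + 0) t) ⟩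
    (A + x + p * t) + (P′ + Q′) * t         ≡⟨ cong (_+ (P′ + Q′) * t) eq ⟩
    (B + y + q * t) + (P′ + Q′) * t         ≡⟨ r₃ B y q P′ Q′ t ⟩
    (B + Q′ * t) + (y + (q + P′) * t)       ≡⟨ cong (_+ (y + (q + P′) * t)) (sym (toℕ-mod (s + ℕ.suc d) t)) ⟩
    s + ℕ.suc d + (y + (q + P′) * t)        ≡⟨ r₄ s (ℕ.suc d) y (q + P′) t ⟩
    s + (ℕ.suc d + y + (q + P′) * t)        ∎)

  x≤d : x ≤ d
  x≤d = ℕ.≤-trans (ℕ.m≤m+n x y) le

  y≤d : y ≤ d
  y≤d = ℕ.≤-trans (ℕ.m≤n+m y x) le

  x< : x < ℕ.suc d + y
  x< = ℕ.≤-trans (s≤s x≤d) (ℕ.m≤m+n _ y)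

  sum<t : ℕ.suc d + y < t
  sum<t = ℕ.≤-trans
    (subst (ℕ.suc d + y <_) (cong (ℕ.suc d +_) (sym (ℕ.+-identityʳ (ℕ.suc d))))
      (ℕ.+-monoʳ-< (ℕ.suc d) (s≤s y≤d)))
    bound

  -- Both sides are already reduced modulo t.
  x≡ : x ≡ ℕ.suc d + y
  x≡ = begin
    x                                    ≡⟨ m<n⇒m%n≡m (ℕ.<-trans x< sum<t) ⟨
    x % t                                ≡⟨ [m+kn]%n≡m%n x (p + Q′) t ⟨
    (x + (p + Q′) * t) % t               ≡⟨ cong (_% t) eqℕ ⟩
    (ℕ.suc d + y + (q + P′) * t) % t     ≡⟨ [m+kn]%n≡m%n (ℕ.suc d + y) (q + P′) t ⟩
    (ℕ.suc d + y) % t                    ≡⟨ m<n⇒m%n≡m sum<t ⟩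
    ℕ.suc d + y                          ∎

-- Neighbours, and the chords of a simple path

module _ {n} (G : Graph n) where
  open Graph G

  -- The neighbours of v, each listed once.
  nbrs : Fin n → List (Fin n)
  nbrs v = filter (λ w → T? (adj v w)) (allFin n)

  length-nbrs : ∀ v → length (nbrs v) ≡ degree v
  length-nbrs v = length-filter-tabulate (adj v) id

  nbrs-unique : ∀ v → Unique (nbrs v)
  nbrs-unique v = Unique.filter⁺ _ (Unique.allFin⁺ n)

  ∈-nbrs⁺ : ∀ {v w} → Adj v w → w ∈ nbrs v
  ∈-nbrs⁺ {v} {w} e = Mem.∈-filter⁺ _ (Mem.∈-allFin w) e

  ∈-nbrs⁻ : ∀ {v w} → w ∈ nbrs v → Adj v w
  ∈-nbrs⁻ {v} {w} w∈ = proj₂ (Mem.∈-filter⁻ (λ y → T? (adj v y)) {xs = allFin n} w∈)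

  adj-flip : ∀ {v w} → Adj v w → Adj w v
  adj-flip {v} {w} = subst T (adj-sym v w)

  ¬adj-self : ∀ {v} → ¬ Adj v v
  ¬adj-self {v} e = subst T (adj-irrefl v) e

  source∈ : ∀ {v w} (p : Walk v w) → v ∈ vertices p
  source∈ nil        = here refl
  source∈ (cons _ _) = here refl

  target∈ : ∀ {v w a b} (p : Walk v w) → (a , b) ∈ edges p → b ∈ vertices p
  target∈ (cons e p) (here refl) = there (source∈ p)
  target∈ (cons e p) (there m)   = there (target∈ p m)

  no-edge-into-start : ∀ {v w a} (p : Walk v w) → Unique (vertices p) → ¬ (a , v) ∈ edges p
  no-edge-into-start (cons e p) (v∉ ∷ _) (here refl) = All.lookup v∉ (source∈ p) refl
  no-edge-into-start (cons e p) (v∉ ∷ _) (there m)   =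
    All.lookup v∉ (target∈ p m) refl

  edge-into-unique : ∀ {v w a b x} (p : Walk v w) → Unique (vertices p) →
    (a , x) ∈ edges p → (b , x) ∈ edges p → a ≡ b
  edge-into-unique (cons e p) _       (here refl) (here refl) = refl
  edge-into-unique (cons e p) (_ ∷ u) (here refl) (there m)   = ⊥-elim (no-edge-into-start p u m)
  edge-into-unique (cons e p) (_ ∷ u) (there m)   (here refl) = ⊥-elim (no-edge-into-start p u m)
  edge-into-unique (cons e p) (_ ∷ u) (there m)   (there m′)  = edge-into-unique p u m m′

  -- Cutting a simple path at one of its vertices leaves a simple path.
  prefix : ∀ {v w y} (p : Walk v w) → Unique (vertices p) → y ∈ vertices p →
    Σ[ q ∈ Walk v y ] Unique (vertices q) × (∀ {z} → z ∈ vertices q → z ∈ vertices p)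
  prefix nil        u       (here refl) = nil , u , id
  prefix (cons e p) _       (here refl) = nil , [] ∷ [] , λ { (here eq) → here eq }
  prefix (cons e p) (v∉ ∷ u) (there m)  with prefix p u m
  ... | q , uq , sub = cons e q
      , All.tabulate (λ z∈ → All.lookup v∉ (sub z∈)) ∷ uq
      , λ { (here eq) → here eq ; (there z∈) → there (sub z∈) }

  module _ (acyclic : Acyclic) where

    -- Otherwise the chord closes a cycle with a prefix of the path.
    chord-from-start : ∀ {v x w y} (e : Adj v x) (p : Walk x w) →
      Unique (vertices (cons e p)) → y ∈ vertices p → Adj v y → y ≡ x
    chord-from-start e p (v∉ ∷ u) y∈ a with prefix p u y∈
    ... | nil        , _  , _   = refl
    ... | cons e′ q  , uq , sub = ⊥-elim
      (acyclic (cons e (cons e′ q) , All.tabulate (λ z∈ → All.lookup v∉ (sub z∈)) ∷ uq)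
               (s≤s (s≤s z≤n)) (adj-flip a))

    -- In an acyclic graph, adjacent vertices of a simple path are consecutive.
    chord⇒edge : ∀ {v w x y} (p : Walk v w) → Unique (vertices p) →
      x ∈ vertices p → y ∈ vertices p → Adj x y → (x , y) ∈ edges p ⊎ (y , x) ∈ edges p
    chord⇒edge nil        _ (here refl) (here refl) a = ⊥-elim (¬adj-self a)
    chord⇒edge (cons e p) _ (here refl) (here refl) a = ⊥-elim (¬adj-self a)
    chord⇒edge (cons e p) u (here refl) (there y∈)  a
      with refl ← chord-from-start e p u y∈ a = inj₁ (here refl)
    chord⇒edge (cons e p) u (there x∈)  (here refl) a
      with refl ← chord-from-start e p u x∈ (adj-flip a) = inj₂ (here refl)
    chord⇒edge (cons e p) (_ ∷ u) (there x∈) (there y∈) a with chord⇒edge p u x∈ y∈ a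
    ... | inj₁ m = inj₁ (there m)
    ... | inj₂ m = inj₂ (there m)

  -- The edges at x other than the one to u, as pairs with first component x.
  fan : Fin n → Fin n → List (Fin n × Fin n)
  fan u x = map (x ,_) (filter (λ y → ¬? (y Fin.≟ u)) (nbrs x))

  ∈-fan⁻ : ∀ {u x a b} → (a , b) ∈ fan u x → a ≡ x × Adj x b × b ≢ u
  ∈-fan⁻ {u} {x} m with Mem.∈-map⁻ (x ,_) m
  ... | y , y∈ , refl with Mem.∈-filter⁻ (λ y → ¬? (y Fin.≟ u)) {xs = nbrs x} y∈
  ... | y∈nbrs , y≢u = refl , ∈-nbrs⁻ y∈nbrs , y≢u

  fan-unique : ∀ u x → Unique (fan u x)
  fan-unique u x = Unique.map⁺ ,-injectiveʳ (Unique.filter⁺ _ (nbrs-unique x))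

  degree≤fan : ∀ u x → degree x ≤ ℕ.suc (length (fan u x))
  degree≤fan u x = subst₂ _≤_ (length-nbrs x)
    (cong ℕ.suc (sym (length-map (x ,_) (filter (λ y → ¬? (y Fin.≟ u)) (nbrs x)))))
    (unique-⊆⇒≤ (nbrs-unique x) cover)
    where
    cover : ∀ {y} → y ∈ nbrs x → y ∈ u ∷ filter (λ y → ¬? (y Fin.≟ u)) (nbrs x)
    cover {y} y∈ with y Fin.≟ u
    ... | yes y≡u = here y≡u
    ... | no  y≢u = there (Mem.∈-filter⁺ _ y∈ y≢u)

  -- The fans at the vertices of a walk after the first, each omitting the
  -- edge by which the walk arrives.
  fans : ∀ {v w} → Walk v w → List (Fin n × Fin n)
  fans nil                = []
  fans (cons {u} {x} e p) = fan u x ++ fans p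

  ∈-fans⁻ : ∀ {v w a b} (p : Walk v w) → (a , b) ∈ fans p →
    ∃[ c ] (c , a) ∈ edges p × Adj a b × b ≢ c
  ∈-fans⁻ (cons {u} {x} e p) m with Mem.∈-++⁻ (fan u x) m
  ... | inj₁ m₁ with refl , adj , b≢u ← ∈-fan⁻ m₁ = u , here refl , adj , b≢u
  ... | inj₂ m₂ with c , c∈ , adj , b≢c ← ∈-fans⁻ p m₂ = c , there c∈ , adj , b≢c

  fans-avoid-start : ∀ {v w b} (p : Walk v w) → Unique (vertices p) → ¬ (v , b) ∈ fans p
  fans-avoid-start p u m with _ , c∈ , _ ← ∈-fans⁻ p m = no-edge-into-start p u c∈

  fans-unique : ∀ {v w} (p : Walk v w) → Unique (vertices p) → Unique (fans p)
  fans-unique nil                _       = []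
  fans-unique (cons {u} {x} e p) (_ ∷ up) =
    Unique.++⁺ (fan-unique u x) (fans-unique p up)
      λ { (m₁ , m₂) → disjoint m₁ m₂ }
    where
    disjoint : ∀ {z} → z ∈ fan u x → ¬ z ∈ fans p
    disjoint m₁ m₂ with refl , _ ← ∈-fan⁻ m₁ = fans-avoid-start p up m₂

-- Colours along a walk

module _ {n} {G : Graph n} {t} .{{_ : NonZero t}} (c : IntervalCyclicColoring G t) where
  open Graph G
  open IntervalCyclicColoring c

  -- The colour of an edge, as a natural number below t.
  colour : ∀ v w → Adj v w → ℕ
  colour v w e = toℕ (color {v} {w} e)

  near-at : ∀ {D} v {x y} → degree v ≤ ℕ.suc D → (e : Adj v x) (e′ : Adj v y) →
    Near t D (colour v x e) (colour v y e′)
  near-at {D} v {x} {y} d≤ e e′ with cyclic v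
  ... | s , f with Equivalence.to (f (color {v} {x} e)) (x , e , refl)
                 | Equivalence.to (f (color {v} {y} e′)) (y , e′ , refl)
  ... | i , i< , eqᵢ | j , j< , eqⱼ =
    subst₂ (Near t D) (cong toℕ (sym eqᵢ)) (cong toℕ (sym eqⱼ))
      (near-interval {i} {j} s t (ℕ.≤-trans i< d≤) (ℕ.≤-trans j< d≤))

  degree≤colours : ∀ v → degree v ≤ t
  degree≤colours v = subst (_≤ t) (length-nbrs G v)
    (unique-injective⇒≤ (nbrs-unique G v)
      (λ {w} w∈ → color {v} {w} (∈-nbrs⁻ G w∈))
      (λ p q eq → proper (∈-nbrs⁻ G p) (∈-nbrs⁻ G q) eq))

-- The tree

module _ {n} (T′ : Tree n) where
  open Tree T′
  private module G~ = Graph tilde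
  open DecMembership (Fin._≟_ {n}) using (_∈?_)

  -- Leaf v is by definition also the adjacency of v and the centre in tilde.
  Leaf : Fin n → Set
  Leaf v = T (Vec.lookup L v)

  leaf-degree : ∀ {v} → Leaf v → degree v ≡ 1
  leaf-degree {v} l = ℕ.≡ᵇ⇒≡ _ _ (subst T (lookup∘tabulate (λ v → degree v ≡ᵇ 1) v) l)

  degree~-centre : G~.degree zero ≡ ∣ L ∣
  degree~-centre = cong ∣_∣ (tabulate∘lookup L)

  degree~-leaf : ∀ {v} → Leaf v → G~.degree (suc v) ≡ 2
  degree~-leaf {v} l with Vec.lookup L v in eq
  ... | true = cong ℕ.suc (leaf-degree (subst T (sym eq) _))

  degree~-inner : ∀ {v} → ¬ Leaf v → G~.degree (suc v) ≡ degree v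
  degree~-inner {v} ¬l with Vec.lookup L v
  ... | true  = ⊥-elim (¬l _)
  ... | false = refl

  two-neighbours⇒¬leaf : ∀ {v x y} → Adj v x → Adj v y → x ≢ y → ¬ Leaf v
  two-neighbours⇒¬leaf {v} {x} {y} a b x≢y l = ℕ.<-irrefl refl (subst (2 ≤_)
    (trans (length-nbrs graph v) (leaf-degree {v} l))
    (unique-⊆⇒≤ {xs = x ∷ y ∷ []} ((x≢y ∷ []) ∷ [] ∷ [])
      λ { (here refl) → ∈-nbrs⁺ graph a ; (there (here refl)) → ∈-nbrs⁺ graph b }))

  first-edge : ∀ {v w} (p : Walk v w) → v ≢ w → ∃[ x ] (v , x) ∈ edges p
  first-edge nil              v≢w = ⊥-elim (v≢w refl)
  first-edge (cons {v = x} e p) _ = x , here refl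

  -- The fan pairs of the path, together with its first edge, are distinct. As
  -- the tree has no cycle, a fan pair whose second vertex is on the path is an
  -- edge of the path; the other fan pairs are boundary edges.
  fans<LP : ∀ {v w} → v ≢ w → length (fans graph (P v w)) < LP v w
  fans<LP {v} {w} v≢w = subst (length (fans graph p) <_) (length-++ (EP v w))
    (unique-⊆⇒≤ (¬Any⇒All¬ _ (fans-avoid-start graph p u) ∷ fans-unique graph p u) cover)
    where
    p = P v w
    u = proj₂ (connected v w)

    x = proj₁ (first-edge p v≢w)

    fan-cover : ∀ {z} → z ∈ fans graph p → z ∈ EP v w ++ boundary v w
    fan-cover {a , b} m with ∈-fans⁻ graph p m
    ... | c , c∈ , adj , b≢c with b ∈? VP v w
    ...   | no  b∉ = Mem.∈-++⁺ʳ (EP v w)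
            (Mem.∈-filter⁺ _ (Mem.∈-cartesianProduct⁺ (Mem.∈-allFin a) (Mem.∈-allFin b))
              (adj , target∈ graph p c∈ , b∉))
    ...   | yes b∈ with chord⇒edge graph acyclic p u (target∈ graph p c∈) b∈ adj
    ...     | inj₁ ab∈ = Mem.∈-++⁺ˡ ab∈
    ...     | inj₂ ba∈ = ⊥-elim (b≢c (edge-into-unique graph p u ba∈ c∈))

    cover : ∀ {z} → z ∈ (v , x) ∷ fans graph p → z ∈ EP v w ++ boundary v w
    cover (here refl) = Mem.∈-++⁺ˡ (proj₂ (first-edge p v≢w))
    cover (there m)   = fan-cover m

  LP≤M : ∀ {v w} → v Fin.< w → LP v w ≤ M
  LP≤M {v} {w} v<w = All.lookup (xs≤max 0 _)
    (Mem.∈-map⁺ (λ (v , w) → LP v w)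
      (Mem.∈-filter⁺ (λ (v , w) → v Fin.<? w)
        (Mem.∈-cartesianProduct⁺ (Mem.∈-allFin v) (Mem.∈-allFin w)) v<w))

  module _ {t} .{{_ : NonZero t}} (c : IntervalCyclicColoring tilde t) where
    open IntervalCyclicColoring c

    private
      col : ∀ v w → G~.Adj v w → ℕ
      col = colour c

    -- The colour moves by at most the size of a fan at an inner vertex, which
    -- is not a leaf and so has the same degree in both graphs, and by at most
    -- 1 at the final leaf.
    near-walk : ∀ {u x w} (e : Adj u x) (p : Walk x w) → Unique (vertices (cons e p)) →
      (l : Leaf w) →
      Near t (length (fans graph (cons e p)) + 1)
        (col (suc u) (suc x) e) (col (suc w) zero l)
    near-walk {u} {w} e nil _ l =
      near-weaken (ℕ.m≤n+m 1 (length (fans graph (cons e nil))))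
        (subst (λ a → Near t 1 a (col (suc w) zero l))
          (cong toℕ (color-sym (adj-flip graph e) e))
          (near-at c (suc w) (ℕ.≤-reflexive (degree~-leaf {w} l)) (adj-flip graph e) l))
    near-walk {u} {x} {w} e (cons {v = y} e′ p) ((_ ∷ u∉) ∷ up) l =
      subst (λ d → Near t d (col (suc u) (suc x) e) (col (suc w) zero l)) total
        (near-trans
          (subst (λ a → Near t (length (fan graph u x)) a (col (suc x) (suc y) e′))
            (cong toℕ (color-sym (adj-flip graph e) e))
            (near-at c (suc x)
              (subst (_≤ ℕ.suc (length (fan graph u x))) (sym (degree~-inner {x} inner))
                (degree≤fan graph u x))
              (adj-flip graph e) e′))
          (near-walk e′ p up l))
      where
      inner : ¬ Leaf x
      inner = two-neighbours⇒¬leaf (adj-flip graph e) e′ (All.lookup u∉ (source∈ graph p))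

      total : length (fan graph u x) + (length (fans graph (cons e′ p)) + 1)
            ≡ length (fan graph u x ++ fans graph (cons e′ p)) + 1
      total = trans (sym (ℕ.+-assoc (length (fan graph u x)) _ 1))
        (cong (_+ 1) (sym (length-++ (fan graph u x))))

    -- At the initial leaf the colour moves by at most 1 as well.
    near-path : ∀ {v w} (p : Walk v w) → Unique (vertices p) → v ≢ w →
      (l : Leaf v) (l′ : Leaf w) →
      Near t (1 + (length (fans graph p) + 1)) (col (suc v) zero l) (col (suc w) zero l′)
    near-path nil _ v≢w = ⊥-elim (v≢w refl)
    near-path {v} (cons e p) u _ l l′ =
      near-trans (near-at c (suc v) (ℕ.≤-reflexive (degree~-leaf {v} l)) l e)
                 (near-walk e p u l′)

    near-ordered-leaves : ∀ {v w} → v Fin.< w → (l : Leaf v) (l′ : Leaf w) →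
      Near t (ℕ.suc M) (col (suc v) zero l) (col (suc w) zero l′)
    near-ordered-leaves {v} {w} v<w l l′ =
      near-weaken
        (s≤s (subst (_≤ M) (ℕ.+-comm 1 (length (fans graph (P v w))))
          (ℕ.≤-trans (fans<LP v≢w) (LP≤M v<w))))
        (near-path (P v w) (proj₂ (connected v w)) v≢w l l′)
      where
      v≢w : v ≢ w
      v≢w = Fin.<⇒≢ v<w

    near-leaves : ∀ {v w} (l : Leaf v) (l′ : Leaf w) →
      Near t (ℕ.suc M) (col zero (suc v) l) (col zero (suc w) l′)
    near-leaves {v} {w} l l′ =
      subst₂ (Near t (ℕ.suc M)) (cong toℕ (color-sym l l)) (cong toℕ (color-sym l′ l′)) from-leaves
      where
      from-leaves : Near t (ℕ.suc M) (col (suc v) zero l) (col (suc w) zero l′)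
      from-leaves with Fin.<-cmp v w
      ... | tri< v<w _ _  = near-ordered-leaves v<w l l′
      ... | tri> _ _ w<v  = near-sym (near-ordered-leaves w<v l′ l)
      ... | tri≈ _ refl _ with refl ← T-irrelevant l l′ = near-weaken z≤n near-refl

    -- The colours of the edges at the centre form an interval with |L|
    -- elements, so the colours in places 0 and M + 2 both occur there.
    few-leaves : ¬ 2 * (M + 2) ≤ ∣ L ∣
    few-leaves many = contradict at-0 at-M+2
      where
      s = proj₁ (cyclic zero)

      OccursAtCentre : ℕ → Set
      OccursAtCentre i = ∃[ w ] Σ[ e ∈ G~.Adj zero w ] color {zero} {w} e ≡ (s + i) mod t

      occurs : ∀ i → i < G~.degree zero → OccursAtCentre i
      occurs i i< = Equivalence.from (proj₂ (cyclic zero) ((s + i) mod t)) (i , i< , refl)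

      many~ : 2 * ℕ.suc (ℕ.suc M) ≤ G~.degree zero
      many~ = subst₂ _≤_ (cong (2 *_) (ℕ.+-comm M 2)) (sym degree~-centre) many

      M+2< : ℕ.suc (ℕ.suc M) < G~.degree zero
      M+2< = ℕ.<-≤-trans (ℕ.m<m+n (ℕ.suc (ℕ.suc M)) (s≤s z≤n)) many~

      at-0 : OccursAtCentre 0
      at-0 = occurs 0 (ℕ.≤-<-trans z≤n M+2<)

      at-M+2 : OccursAtCentre (ℕ.suc (ℕ.suc M))
      at-M+2 = occurs (ℕ.suc (ℕ.suc M)) M+2<

      contradict : OccursAtCentre 0 → OccursAtCentre (ℕ.suc (ℕ.suc M)) → ⊥
      contradict (suc v , l , eq) (suc w , l′ , eq′) =
        far-apart s (ℕ.≤-trans many~ (degree≤colours c zero))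
          (subst₂ (Near t (ℕ.suc M)) (cong toℕ eq) (cong toℕ eq′) (near-leaves {v} {w} l l′))

theorem35 : ∀ {n : ℕ} → 2 ≤ n → (T : Tree n) →
    2 * (Tree.M T + 2) ≤ ∣ Tree.L T ∣ → Tree.tilde T ∉ 𝔑c
theorem35 _ T many (_ , t≢0 , c) = few-leaves T {{t≢0}} c many
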